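{- Let $\mathit{Exp}$ be the set of conditional expressions over a set $A$ of symbols, and let $\prec$ be the recursion relation on $\mathit{Exp}$ of the normalization function $norm$, as defined in the context. Then $\prec$ is well-founded; that is, for every predicate $P$ on $\mathit{Exp}$, $$\Bigl(\forall x.\,\bigl(\forall x'.\,x'\prec x\Rightarrow P(x')\bigr)\Rightarrow P(x)\Bigr)\;\Longrightarrow\;\forall x.\,P(x),$$ where $x,x'$ range over $\mathit{Exp}$.
   Context: Fix a set $A$ of symbols. The set $\mathit{Exp}$ of conditional expressions is the inductive type freely generated by the constructors $At(a)$ for $a\in A$ and $\mathit{If}(x,y,z)$ for $x,y,z\in\mathit{Exp}$. The normalization function $norm$ is given by the recursion equations $$norm(At(a))=At(a),$$ $$norm(\mathit{If}(At(a),y,z))=\mathit{If}(At(a),norm(y),norm(z)),$$ $$norm(\mathit{If}(\mathit{If}(u,v,w),y,z))=norm(\mathit{If}(u,\mathit{If}(v,y,z),\mathit{If}(w,y,z))).$$ Its recursion relation $\prec$ on $\mathit{Exp}$ ($x'\prec x$ meaning that evaluating $norm(x)$ makes the recursive call $norm(x')$) is defined by cases on the right-hand argument: $$x\prec At(a)\iff \textit{false},$$ $$x\prec \mathit{If}(At(a),y,z)\iff x=y\lor x=z,$$ $$x\prec \mathit{If}(\mathit{If}(u,v,w),y,z)\iff x=\mathit{If}(u,\mathit{If}(v,y,z),\mathit{If}(w,y,z)).$$ A relation is called well-founded if its rule of well-founded induction is sound for every predicate $P$. -}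

module Defs where

open import Level using (Level)
open import Data.Empty.Polymorphic using (⊥)
open import Data.Sum.Base using (_⊎_)
open import Relation.Binary.Core using (Rel)
open import Relation.Binary.PropositionalEquality.Core using (_≡_)

private
  variable
    a : Level
    A : Set a

data Exp {a : Level} (A : Set a) : Set a where
  At : A → Exp A
  If : Exp A → Exp A → Exp A → Exp A

infix 4 _≺_

-- x′ ≺ x means that evaluating norm x makes the recursive call norm x′, where
--   norm (At a)              = At a
--   norm (If (At a) y z)     = If (At a) (norm y) (norm z)
--   norm (If (If u v w) y z) = norm (If u (If v y z) (If w y z))
-- The last equation is not structurally recursive, so norm itself is not
-- definable by these equations before _≺_ is known to be well-founded.
_≺_ : Rel (Exp A) _
x ≺ At _              = ⊥
x ≺ If (At _) y z     = x ≡ y ⊎ x ≡ z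
x ≺ If (If u v w) y z = x ≡ If u (If v y z) (If w y z)

-- Structural induction suffices: a ≺-inductive predicate P passes from y and z
-- to If x y z for every x.  In the step x = If u v w, the hypotheses for v and w
-- give P (If v y z) and P (If w y z), to which the hypothesis for u applies; it
-- must therefore be general in the two branches.

{-# OPTIONS --safe #-}
module Submission where

open import Defs
open import Level using (Level)
open import Data.Sum.Base using (inj₁; inj₂)
open import Relation.Binary.PropositionalEquality.Core using (refl)
open import Relation.Unary using (Pred)

module _ {a ℓ : Level} {A : Set a} (P : Pred (Exp A) ℓ)
         (step : ∀ x → (∀ x′ → x′ ≺ x → P x′) → P x) where

  P-If : ∀ x {y z} → P y → P z → P (If x y z)
  P-If (At _) py pz = step _ λ where
    _ (inj₁ refl) → py
    _ (inj₂ refl) → pz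
  -- The sole predecessor duplicates `y` and `z` and so is larger than the expression itself; yet
  -- the three calls are at `u`, `v` and `w`, proper subterms of the test, so the recursion is
  -- structural in the test alone.
  P-If (If u v w) py pz = step _ λ where
    _ refl → P-If u (P-If v py pz) (P-If w py pz)

mainTheorem1 : ∀ {a ℓ : Level} (A : Set a) (P : Pred (Exp A) ℓ) →
    (∀ x → (∀ x′ → x′ ≺ x → P x′) → P x) →
    ∀ x → P x
mainTheorem1 A P step (At b)     = step (At b) λ _ ()
mainTheorem1 A P step (If x y z) =
  -- Recursion here descends only into the branches; the test `x` is taken apart inside `P-If`.
  P-If P step x (mainTheorem1 A P step y) (mainTheorem1 A P step z)
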